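{- Let $\vec U$ be a universe of separations and let $\vec S\subseteq \vec U$ be a submodular separation system. Then $\vec S$ contains a tree set of separations that distinguishes all the abstract tangles of $S$; that is, there is a tree set $\vec N\subseteq\vec S$ such that for any two distinct abstract tangles $\tau_1,\tau_2$ of $S$ there is an (unoriented) separation $s$ with both orientations in $\vec N$ and $\tau_1\cap s\neq\tau_2\cap s$.
   Context: A separation system $(\vec S,\le,{}^*)$ is a partially ordered set with an order-reversing involution $^*:\vec S\to\vec S$. Its elements are called oriented separations. An (unoriented) separation is a set $s=\{\vec s,\vec s^{\,*}\}$; its elements are its orientations; $S$ denotes the set of all these unoriented separations. $\vec s$ is degenerate if $\vec s=\vec s^{\,*}$. A universe of separations is a separation system $\vec U$ whose partial order is a lattice (join $\vee$, meet $\wedge$). A separation system $\vec S\subseteq\vec U$ is a subset closed under $^*$, with the induced order and involution. It is submodular if for all $\vec s,\vec t\in\vec S$ at least one of $\vec s\vee\vec t$, $\vec s\wedge\vec t$ (computed in $\vec U$) lies in $\vec S$. $\vec s$ is small if $\vec s\le\vec s^{\,*}$; then $\vec s^{\,*}$ is co-small (so $\vec x$ is co-small iff $\vec x^{\,*}\le\vec x$). $\vec s$ is trivial in a separation system if that system contains $\vec t,\vec t^{\,*}$ with $\vec s<\vec t$ and $\vec s<\vec t^{\,*}$. Two separations $s,t$ are nested if they have orientations $\vec s,\vec t$ with $\vec s\le\vec t$. A tree set is a separation system in which any two separations are nested and which has no trivial (in itself) and no degenerate elements. An orientation of $S$ is a set $O\subseteq\vec S$ containing exactly one of $\vec s,\vec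 s^{\,*}$ for every $s\in S$ (the single element, if $s$ is degenerate). It is consistent if whenever $r,s\in S$ are distinct with orientations $\vec r\le\vec s\in O$, then $\vec r^{\,*}\notin O$. Let $\mathcal T$ be the set of all sets $\{\vec r,\vec s,\vec t\}\subseteq\vec U$ ($\vec r,\vec s,\vec t$ not necessarily distinct) such that $\vec r\vee\vec s\vee\vec t$ is co-small. An abstract tangle of $S$ is a consistent orientation $O$ of $S$ such that no subset of $O$ is an element of $\mathcal T$.
   Formalization: The separation system S is assumed finite (the universe U need not be), since the claim fails for infinite S, e.g. all subsets of the natural numbers under complement; the partial order is assumed decidable, which excluded middle supplies. -}

module Defs where

open import Level using (Level; _⊔_; suc)
open import Algebra.Core using (Op₁; Op₂)
open import Algebra.Definitions using (Involutive)
open import Data.List.Base using (List)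
import Data.List.Membership.Setoid as Membership
open import Data.Product using (∃; ∃!; ∃-syntax; _×_)
open import Data.Sum using (_⊎_)
open import Function.Bundles using (_⇔_)
open import Relation.Binary.Core using (Rel)
open import Relation.Binary.Definitions using (Antitonic₁; _Respects_)
open import Relation.Binary.Structures using (IsPartialOrder)
open import Relation.Binary.Bundles using (Setoid)
open import Relation.Binary.Lattice.Definitions using (Supremum; Infimum)
open import Relation.Binary.Lattice.Bundles using (Lattice)
import Relation.Binary.Construct.NonStrictToStrict as Strict
open import Relation.Nullary.Negation using (¬_)
open import Relation.Unary using (Pred; _∈_; _∉_; _⊆_; _≐_; _∩_)

record SeparationSystem c ℓ₁ ℓ₂ : Set (suc (c ⊔ ℓ₁ ⊔ ℓ₂)) where
  infix  4 _≈_ _≤_ _<_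
  infixl 9 _*
  field
    Carrier        : Set c
    _≈_            : Rel Carrier ℓ₁
    _≤_            : Rel Carrier ℓ₂
    isPartialOrder : IsPartialOrder _≈_ _≤_
    _*             : Op₁ Carrier
    *-involutive   : Involutive _≈_ _*
    *-antitone     : Antitonic₁ _≤_ _≤_ _*

  open IsPartialOrder isPartialOrder public

  setoid : Setoid c ℓ₁
  setoid = record { isEquivalence = isEquivalence }

  _<_ : Rel Carrier (ℓ₁ ⊔ ℓ₂)
  _<_ = Strict._<_ _≈_ _≤_

  -- The unoriented separation {x , x *}.
  ⌞_⌟ : Carrier → Pred Carrier ℓ₁
  ⌞ x ⌟ y = (y ≈ x) ⊎ (y ≈ x *)

  Degenerate : Pred Carrier ℓ₁
  Degenerate x = x ≈ x *

  Small : Pred Carrier ℓ₂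
  Small x = x ≤ x *

  CoSmall : Pred Carrier ℓ₂
  CoSmall x = x * ≤ x

  Nested : Rel Carrier (c ⊔ ℓ₁ ⊔ ℓ₂)
  Nested x y = ∃[ r ] ∃[ s ] (r ∈ ⌞ x ⌟ × s ∈ ⌞ y ⌟ × r ≤ s)

  -- A separation system contained in the given one; its order and
  -- involution are the induced ones.
  record Subsystem ℓ : Set (c ⊔ ℓ₁ ⊔ suc ℓ) where
    field
      elements  : Pred Carrier ℓ
      respects  : elements Respects _≈_
      *-closed  : ∀ {x} → x ∈ elements → x * ∈ elements

  open Subsystem public using (elements)

  module _ {ℓ} (S : Subsystem ℓ) where

    Finite : Set (c ⊔ ℓ₁ ⊔ ℓ)
    Finite = ∃[ xs ] (∀ x → (x ∈ elements S) ⇔ (x ∈ₗ xs))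
      where open Membership setoid using () renaming (_∈_ to _∈ₗ_)

    TrivialIn : Pred Carrier (c ⊔ ℓ₁ ⊔ ℓ₂ ⊔ ℓ)
    TrivialIn x = ∃[ t ] (t ∈ elements S × t * ∈ elements S × x < t × x < t *)

    record IsTreeSet : Set (c ⊔ ℓ₁ ⊔ ℓ₂ ⊔ ℓ) where
      field
        nested        : ∀ {x y} → x ∈ elements S → y ∈ elements S → Nested x y
        nontrivial    : ∀ {x} → x ∈ elements S → ¬ TrivialIn x
        nondegenerate : ∀ {x} → x ∈ elements S → ¬ Degenerate x

    record IsOrientation {o} (O : Pred Carrier o) : Set (c ⊔ ℓ₁ ⊔ ℓ ⊔ o) where
      field
        respects   : O Respects _≈_
        subset     : O ⊆ elements S
        exactlyOne : ∀ {x} → x ∈ elements S → ∃! _≈_ (O ∩ ⌞ x ⌟)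

    Consistent : ∀ {o} → Pred Carrier o → Set (c ⊔ ℓ₁ ⊔ ℓ₂ ⊔ ℓ ⊔ o)
    Consistent O = ∀ {r s} → r ∈ elements S → s ∈ elements S →
                   ¬ (⌞ r ⌟ ≐ ⌞ s ⌟) → r ≤ s → s ∈ O → r * ∉ O

  Distinguishes : ∀ {o} → Carrier → Rel (Pred Carrier o) (c ⊔ ℓ₁ ⊔ o)
  Distinguishes s O₁ O₂ = ¬ ((O₁ ∩ ⌞ s ⌟) ≐ (O₂ ∩ ⌞ s ⌟))

record Universe c ℓ₁ ℓ₂ : Set (suc (c ⊔ ℓ₁ ⊔ ℓ₂)) where
  infixr 6 _∨_
  infixr 7 _∧_
  field
    separationSystem : SeparationSystem c ℓ₁ ℓ₂

  open SeparationSystem separationSystem public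

  field
    _∨_      : Op₂ Carrier
    _∧_      : Op₂ Carrier
    supremum : Supremum _≤_ _∨_
    infimum  : Infimum _≤_ _∧_

  lattice : Lattice c ℓ₁ ℓ₂
  lattice = record
    { isLattice = record
      { isPartialOrder = isPartialOrder
      ; supremum       = supremum
      ; infimum        = infimum
      }
    }

  ❴_,_,_❵ : Carrier → Carrier → Carrier → Pred Carrier ℓ₁
  ❴ r , s , t ❵ x = (x ≈ r) ⊎ (x ≈ s) ⊎ (x ≈ t)

  𝒯 : Pred (Pred Carrier ℓ₁) (c ⊔ ℓ₁ ⊔ ℓ₂)
  𝒯 X = ∃[ r ] ∃[ s ] ∃[ t ] (X ≐ ❴ r , s , t ❵ × CoSmall (r ∨ s ∨ t))

  module _ {ℓ} (S : Subsystem ℓ) where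

    Submodular : Set (c ⊔ ℓ)
    Submodular = ∀ {s t} → s ∈ elements S → t ∈ elements S →
                 (s ∨ t ∈ elements S) ⊎ (s ∧ t ∈ elements S)

    record IsAbstractTangle {o} (O : Pred Carrier o)
           : Set (c ⊔ suc ℓ₁ ⊔ ℓ₂ ⊔ ℓ ⊔ o) where
      field
        isOrientation : IsOrientation S O
        consistent    : Consistent S O
        avoids        : ∀ {X} → X ⊆ O → X ∉ 𝒯

{-# OPTIONS --safe #-}

-- For regular profiles P and Q let A(P,Q) be the set of separations in S that
-- distinguish P from Q.  If a ∈ A(P,Q) and b ∈ A(P′,Q′), then either one of
-- them lies in both sets, or they have orientations such that P and Q both
-- contain b while P′ and Q′ both contain a; then the corner a * ∨ b, if it is
-- in S, distinguishes P from Q, and the opposite corner a ∨ b *, if it is in S,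
-- distinguishes P′ from Q′.  By submodularity one of the two is in S.
-- So the sets A(P,Q) splinter, and the splinter lemma of Elbracht, Kneip and
-- Teegen picks pairwise nested representatives.  Regular profiles contain no
-- co-small separations, so a separation distinguishing two of them can be
-- neither trivial nor degenerate.
module Submission where

open import Defs
open import Data.Bool.Base using (true; false)
open import Data.Empty using (⊥-elim)
open import Data.Fin.Base using (Fin; zero; suc; punchIn; punchOut)
open import Data.Fin.Properties using (_≟_; any?; punchIn-punchOut)
open import Data.List.Base using (List; []; _∷_; [_]; map; _++_; filter; length; lookup; cartesianProduct)
open import Data.List.Membership.Propositional using () renaming (_∈_ to _∈≡_)
import Data.List.Membership.Propositional.Properties as ∈≡
import Data.List.Membership.Setoid as Membership
import Data.List.Membership.Setoid.Properties as ∈ₛ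
import Data.List.Relation.Unary.All as All
import Data.List.Relation.Unary.Any as Any
open Any using (here; there)
open import Data.List.Relation.Unary.Any.Properties using (lookup-index)
open import Data.Nat.Base using (zero; suc)
open import Data.Product using (∃; ∃-syntax; _×_; _,_; proj₁; proj₂)
open import Data.Sum using (_⊎_; inj₁; inj₂; [_,_]′) renaming (map to ⊎-map)
open import Data.Vec.Functional using (insertAt)
open import Data.Vec.Functional.Properties using (insertAt-lookup; insertAt-punchIn)
open import Function.Base using (_∘_)
open import Function.Bundles using (module Equivalence)
open import Level using (_⊔_; Lift; lift; lower)
open import Relation.Binary.Core using (Rel)
open import Relation.Binary.Definitions using (Decidable; Reflexive; Symmetric; _Respects_)
open import Relation.Binary.Lattice.Bundles using (module Lattice)
open import Relation.Binary.PropositionalEquality using (_≡_; refl; sym; subst; subst₂)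
open import Relation.Nullary.Decidable using (Dec; yes; no; does; map′; _×-dec_; _⊎-dec_; _→-dec_; ¬?; True; decidable-stable; toWitness; fromWitness)
open import Relation.Nullary.Negation using (¬_; contradiction)
open import Relation.Unary using (Pred; _∈_; _∉_; _⊆_; _≐_; _∩_; Satisfiable)
open import Relation.Unary.Properties using (≐-sym)
import Relation.Unary as Unary

-- Finite index sets and sublists.

∀⊎∃ : ∀ {p q n} {P : Pred (Fin n) p} {Q : Pred (Fin n) q} →
      (∀ i → P i ⊎ Q i) → (∀ i → P i) ⊎ (∃ Q)
∀⊎∃ {n = zero}  f = inj₁ λ ()
∀⊎∃ {n = suc n} f with f zero | ∀⊎∃ (f ∘ suc)
... | inj₂ q | _            = inj₂ (zero , q)
... | inj₁ _ | inj₂ (i , q) = inj₂ (suc i , q)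
... | inj₁ p | inj₁ ps      = inj₁ λ { zero → p ; (suc i) → ps i }

punchIn-elim : ∀ {p n} {P : Pred (Fin (suc n)) p} (k : Fin (suc n)) →
               P k → (∀ i → P (punchIn k i)) → ∀ i → P i
punchIn-elim {P = P} k pk f i with k ≟ i
... | yes refl = pk
... | no k≢i   = subst P (punchIn-punchOut k≢i) (f (punchOut k≢i))

sublists : ∀ {a} {A : Set a} → List A → List (List A)
sublists []       = [ [] ]
sublists (x ∷ xs) = map (x ∷_) (sublists xs) ++ sublists xs

-- Later this locates the list of members of a tangle among lists enumerated in advance.
filter∈sublists : ∀ {a p} {A : Set a} {P : Pred A p} (P? : Unary.Decidable P) →
                  ∀ xs → filter P? xs ∈≡ sublists xs
filter∈sublists P? [] = here refl
filter∈sublists P? (x ∷ xs) with does (P? x)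
... | true  = ∈≡.∈-++⁺ˡ (∈≡.∈-map⁺ (x ∷_) (filter∈sublists P? xs))
... | false = ∈≡.∈-++⁺ʳ (map (x ∷_) (sublists xs)) (filter∈sublists P? xs)

-- The splinter lemma, for a reflexive symmetric relation.

module Splinter {x r} {X : Set x} (_~_ : Rel X r)
                (~-refl : Reflexive _~_) (~-sym : Symmetric _~_) where

  -- All that the splinter lemma uses of a corner separation is the conclusion of the fish lemma.
  Corner : X → X → X → Set (x ⊔ r)
  Corner a b c = ∀ {t} → t ~ a → t ~ b → t ~ c

  -- The witness may be `a` or `b` itself, since `Corner a b a` and `Corner a b b` always hold;
  -- shared elements and proper corners are thus treated alike.
  SplinterAt : ∀ {q} → Pred X q → Pred X q → Rel X (x ⊔ r ⊔ q)
  SplinterAt A B a b = (∃[ c ] (c ∈ B × c ~ a × Corner a b c)) ⊎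
                       (∃[ c ] (c ∈ A × c ~ b × Corner a b c))

  Splinters : ∀ {q n} → (Fin n → Pred X q) → Set (x ⊔ r ⊔ q)
  Splinters A = ∀ i j {a b} → a ∈ A i → b ∈ A j → SplinterAt (A i) (A j) a b

  NestedChoice : ∀ {q n} → (Fin n → Pred X q) → Set (x ⊔ r ⊔ q)
  NestedChoice {n = n} A =
    ∃ λ (f : Fin n → X) → (∀ i → f i ∈ A i) × (∀ i j → f i ~ f j)

  -- Both `a` and `b` are related to `x`, so the corner property applied to `x` shows that the
  -- witness `c` survives the restriction.
  splinters-restrict : ∀ {q m n} {A : Fin n → Pred X q} (k : Fin m → Fin n) (x : X) →
                       Splinters A → Splinters (λ i → A (k i) ∩ (_~ x))
  splinters-restrict k x spl i j {a} {b} (a∈ , a~x) (b∈ , b~x) =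
    ⊎-map keep keep (spl (k i) (k j) a∈ b∈)
    where
    keep : ∀ {q} {C : Pred X q} {y} →
           ∃[ c ] (c ∈ C × c ~ y × Corner a b c) →
           ∃[ c ] (c ∈ (C ∩ (_~ x)) × c ~ y × Corner a b c)
    keep (c , c∈ , c~y , corner) =
      c , (c∈ , ~-sym (corner (~-sym a~x) (~-sym b~x))) , c~y , corner

  -- If, for the representatives g of the other sets, every corner falls on
  -- the side of A (suc i), then a is a pivot; otherwise some g i is.
  pivot : ∀ {q n} (A : Fin (suc n) → Pred X q) → Splinters A →
          Satisfiable (A zero) → NestedChoice (A ∘ suc) →
          ∃[ k ] ∃[ x ] (x ∈ A k × (∀ j → Satisfiable (A j ∩ (_~ x))))
  pivot A spl (a , a∈) (g , g∈ , g~) with ∀⊎∃ (λ i → spl zero (suc i) a∈ (g∈ i))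
  ... | inj₁ near = zero , a , a∈ , λ
    { zero    → a , a∈ , ~-refl
    ; (suc i) → let c , c∈ , c~a , _ = near i in c , c∈ , c~a
    }
  ... | inj₂ (i , c , c∈ , c~gi , _) = suc i , g i , g∈ i , λ
    { zero    → c , c∈ , c~gi
    ; (suc j) → g j , g∈ j , g~ j i
    }

  -- Each round intersects the sets with (_~ x), so the level must absorb r.
  splinter-⊔ : ∀ p n (A : Fin n → Pred X (p ⊔ r)) →
               (∀ i → Satisfiable (A i)) → Splinters A → NestedChoice A
  splinter-⊔ p zero    A sat spl = (λ ()) , (λ ()) , λ ()
  splinter-⊔ p (suc n) A sat spl
    with pivot A spl (sat zero)
           (splinter-⊔ p n (A ∘ suc) (sat ∘ suc) (λ i j → spl (suc i) (suc j)))
  ... | k , x , x∈ , near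
    -- The first choice only served to find the pivot. Now `x` represents `A k`, and cutting the
    -- other sets down to elements related to `x` makes every choice from them compatible with `x`.
    with splinter-⊔ p n (λ i → A (punchIn k i) ∩ (_~ x)) (near ∘ punchIn k)
           (splinters-restrict (punchIn k) x spl)
  ... | h , h∈ , h~ = f , f∈ , f~
    where
    f : Fin (suc n) → X
    f = insertAt h k x

    x≡ : x ≡ f k
    x≡ = sym (insertAt-lookup h k x)

    h≡ : ∀ i → h i ≡ f (punchIn k i)
    h≡ i = sym (insertAt-punchIn h k x i)

    f∈ : ∀ i → f i ∈ A i
    f∈ = punchIn-elim k (subst (_∈ A k) x≡ x∈)
           (λ i → subst (_∈ A (punchIn k i)) (h≡ i) (proj₁ (h∈ i)))

    f~ : ∀ i j → f i ~ f j
    f~ = punchIn-elim k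
      (punchIn-elim k (subst₂ _~_ x≡ x≡ ~-refl)
        (λ j → subst₂ _~_ x≡ (h≡ j) (~-sym (proj₂ (h∈ j)))))
      (λ i → punchIn-elim k (subst₂ _~_ (h≡ i) x≡ (proj₂ (h∈ i)))
        (λ j → subst₂ _~_ (h≡ i) (h≡ j) (h~ i j)))

  splinter : ∀ {p n} (A : Fin n → Pred X p) →
             (∀ i → Satisfiable (A i)) → Splinters A → NestedChoice A
  splinter {p} {n} A sat spl =
    let f , f∈ , f~ = splinter-⊔ p n (λ i x → Lift r (x ∈ A i))
          (λ i → let x , x∈ = sat i in x , lift x∈)
          (λ i j a∈ b∈ → ⊎-map lift-corner lift-corner (spl i j (lower a∈) (lower b∈)))
    in f , (λ i → lower (f∈ i)) , f~
    where
    lift-corner : ∀ {C : Pred X p} {y a b} →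
                  ∃[ c ] (c ∈ C × c ~ y × Corner a b c) →
                  ∃[ c ] (Lift r (c ∈ C) × c ~ y × Corner a b c)
    lift-corner (c , c∈ , near) = c , lift c∈ , near

-- The involution, nestedness and the fish lemma.

module Nestedness {c ℓ₁ ℓ₂} (U : Universe c ℓ₁ ℓ₂) where
  open Universe U renaming (refl to ≤-refl; trans to ≤-trans)
  open Lattice lattice public using (x≤x∨y; y≤x∨y; ∨-least; x∧y≤x; x∧y≤y; ∧-greatest)

  *-cong : ∀ {x y} → x ≈ y → x * ≈ y *
  *-cong x≈y = antisym (*-antitone (reflexive (Eq.sym x≈y))) (*-antitone (reflexive x≈y))

  x≤x** : ∀ {x} → x ≤ x * *
  x≤x** = reflexive (Eq.sym (*-involutive _))

  x**≤x : ∀ {x} → x * * ≤ x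
  x**≤x = reflexive (*-involutive _)

  x≤y*⇒y≤x* : ∀ {x y} → x ≤ y * → y ≤ x *
  x≤y*⇒y≤x* x≤y* = ≤-trans x≤x** (*-antitone x≤y*)

  x*≤y⇒y*≤x : ∀ {x y} → x * ≤ y → y * ≤ x
  x*≤y⇒y*≤x x*≤y = ≤-trans (*-antitone x*≤y) x**≤x

  x*≤y*⇒y≤x : ∀ {x y} → x * ≤ y * → y ≤ x
  x*≤y*⇒y≤x x*≤y* = ≤-trans (x≤y*⇒y≤x* x*≤y*) x**≤x

  -- Turns the meet offered by submodularity into the opposite corner, again a join, so that both
  -- outcomes fall under the same lemmas on joins.
  deMorgan : ∀ x y → (x * ∧ y) * ≈ y * ∨ x
  deMorgan x y = antisym
    (x*≤y⇒y*≤x (∧-greatest (*-antitone (y≤x∨y _ _)) (x*≤y⇒y*≤x (x≤x∨y _ _))))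
    (∨-least (*-antitone (x∧y≤y _ _)) (x≤y*⇒y≤x* (x∧y≤x _ _)))

  x∈⌞x⌟ : ∀ {x} → x ∈ ⌞ x ⌟
  x∈⌞x⌟ = inj₁ Eq.refl

  x*∈⌞x⌟ : ∀ {x} → x * ∈ ⌞ x ⌟
  x*∈⌞x⌟ = inj₂ Eq.refl

  x∈⌞x*⌟ : ∀ {x} → x ∈ ⌞ x * ⌟
  x∈⌞x*⌟ = inj₂ (Eq.sym (*-involutive _))

  ⌞⌟-trans : ∀ {x y z} → x ∈ ⌞ y ⌟ → y ∈ ⌞ z ⌟ → x ∈ ⌞ z ⌟
  ⌞⌟-trans (inj₁ x≈y)  (inj₁ y≈z)  = inj₁ (Eq.trans x≈y y≈z)
  ⌞⌟-trans (inj₁ x≈y)  (inj₂ y≈z*) = inj₂ (Eq.trans x≈y y≈z*)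
  ⌞⌟-trans (inj₂ x≈y*) (inj₁ y≈z)  = inj₂ (Eq.trans x≈y* (*-cong y≈z))
  ⌞⌟-trans (inj₂ x≈y*) (inj₂ y≈z*) =
    inj₁ (Eq.trans x≈y* (Eq.trans (*-cong y≈z*) (*-involutive _)))

  ⌞⌟-sym : ∀ {x y} → x ∈ ⌞ y ⌟ → y ∈ ⌞ x ⌟
  ⌞⌟-sym (inj₁ x≈y)  = inj₁ (Eq.sym x≈y)
  ⌞⌟-sym (inj₂ x≈y*) = inj₂ (Eq.trans (Eq.sym (*-involutive _)) (*-cong (Eq.sym x≈y*)))

  ≤⇒nested : ∀ {x y} → x ≤ y → Nested x y
  ≤⇒nested x≤y = _ , _ , x∈⌞x⌟ , x∈⌞x⌟ , x≤y

  nested-refl : Reflexive Nested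
  nested-refl = ≤⇒nested ≤-refl

  nested-sym : Symmetric Nested
  nested-sym (r , s , r∈ , s∈ , r≤s) =
    s * , r * , ⌞⌟-trans x*∈⌞x⌟ s∈ , ⌞⌟-trans x*∈⌞x⌟ r∈ , *-antitone r≤s

  nested-resp : ∀ {x y y′} → y ∈ ⌞ y′ ⌟ → Nested x y → Nested x y′
  nested-resp y∈ (r , s , r∈ , s∈ , r≤s) = r , s , r∈ , ⌞⌟-trans s∈ y∈ , r≤s

  -- Taking inverses where necessary lets `a` keep its given orientation; the price is that the
  -- order may go either way.
  nested-cases : ∀ {t a} → Nested t a →
                 (∃[ u ] (u ∈ ⌞ t ⌟ × u ≤ a)) ⊎ (∃[ u ] (u ∈ ⌞ t ⌟ × a ≤ u))
  nested-cases (r , s , r∈ , inj₁ s≈a  , r≤s) =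
    inj₁ (r , r∈ , ≤-trans r≤s (reflexive s≈a))
  nested-cases (r , s , r∈ , inj₂ s≈a* , r≤s) =
    inj₂ (r * , ⌞⌟-trans x*∈⌞x⌟ r∈ , x≤y*⇒y≤x* (≤-trans r≤s (reflexive s≈a*)))

  -- If an orientation of `t` is below `a` or `b`, it is below the join. Otherwise `t` has
  -- orientations `u` above `a` and `v` above `b`: when they agree, `v` is above the join; when they
  -- are inverse, `a ≤ u ≈ v * ≤ b *`, which is excluded.
  fish : ∀ {a b t} → ¬ (a ≤ b *) → Nested t a → Nested t b → Nested t (a ∨ b)
  fish a≰b* t~a t~b with nested-cases t~a | nested-cases t~b
  ... | inj₁ (u , u∈ , u≤a) | _ =
    u , _ , u∈ , x∈⌞x⌟ , ≤-trans u≤a (x≤x∨y _ _)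
  ... | _ | inj₁ (u , u∈ , u≤b) =
    u , _ , u∈ , x∈⌞x⌟ , ≤-trans u≤b (y≤x∨y _ _)
  ... | inj₂ (u , u∈ , a≤u) | inj₂ (v , v∈ , b≤v) with ⌞⌟-trans u∈ (⌞⌟-sym v∈)
  ...   | inj₁ u≈v  = nested-sym (nested-resp v∈
            (≤⇒nested (∨-least (≤-trans a≤u (reflexive u≈v)) b≤v)))
  ...   | inj₂ u≈v* =
            contradiction (≤-trans a≤u (≤-trans (reflexive u≈v*) (*-antitone b≤v))) a≰b*

  -- Here `(x ∨ y ∨ z) * ≤ z * ≤ x ∨ y ≤ x ∨ y ∨ z`. Every forbidden triple below is recognised by
  -- this criterion.
  joinCoSmall : ∀ {x y z} → z * ≤ x ∨ y → CoSmall (x ∨ y ∨ z)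
  joinCoSmall {x} {y} {z} z*≤x∨y =
    ≤-trans (*-antitone (≤-trans (y≤x∨y y z) (y≤x∨y x _)))
      (≤-trans z*≤x∨y (∨-least (x≤x∨y _ _) (≤-trans (x≤x∨y _ _) (y≤x∨y _ _))))

-- Regular profiles and the separations between them.

module Profiles {c ℓ₁ ℓ₂ ℓ} (U : Universe c ℓ₁ ℓ₂) (S : Universe.Subsystem U ℓ) where
  open Universe U renaming (refl to ≤-refl; trans to ≤-trans)
  open Nestedness U

  -- An order ideal of S closed under those joins that lie in S: the clause
  -- ideal merges consistency with the profile condition.
  record IsRegularProfile {p} (P : Pred Carrier p) : Set (c ⊔ ℓ₁ ⊔ ℓ₂ ⊔ ℓ ⊔ p) where
    field
      respects : P Respects _≈_
      total    : ∀ {x} → x ∈ elements S → x ∈ P ⊎ x * ∈ P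
      ideal    : ∀ {x y z} → x ∈ elements S → y ∈ elements S → z ∈ elements S →
                 z ≤ x ∨ y → x ∈ P → y ∈ P → z ∈ P
      regular  : ∀ {x} → x ∈ elements S → x ∈ P → ¬ CoSmall x

    down : ∀ {x y} → x ∈ elements S → y ∈ elements S → x ≤ y → y ∈ P → x ∈ P
    down x∈S y∈S x≤y y∈P = ideal y∈S y∈S x∈S (≤-trans x≤y (x≤x∨y _ _)) y∈P y∈P

  open IsRegularProfile

  profile-resp-≐ : ∀ {p q} {P : Pred Carrier p} {Q : Pred Carrier q} →
                   P ≐ Q → IsRegularProfile P → IsRegularProfile Q
  profile-resp-≐ (P⊆Q , Q⊆P) prf = record
    { respects = λ x≈y x∈Q → P⊆Q (respects prf x≈y (Q⊆P x∈Q))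
    ; total    = λ x∈S → ⊎-map P⊆Q P⊆Q (total prf x∈S)
    ; ideal    = λ x∈S y∈S z∈S z≤ x∈Q y∈Q →
                   P⊆Q (ideal prf x∈S y∈S z∈S z≤ (Q⊆P x∈Q) (Q⊆P y∈Q))
    ; regular  = λ x∈S x∈Q → regular prf x∈S (Q⊆P x∈Q)
    }

  -- A positive counterpart of `Distinguishes`: it records which orientation each profile contains,
  -- as needed to follow a separation to its corners.
  Separates : ∀ {p q} → Pred Carrier p → Pred Carrier q → Pred Carrier (p ⊔ q)
  Separates P Q x = (x ∈ P × x * ∈ Q) ⊎ (x * ∈ P × x ∈ Q)

  separates-resp-≐ : ∀ {p q p′ q′} {P : Pred Carrier p} {Q : Pred Carrier q}
                     {P′ : Pred Carrier p′} {Q′ : Pred Carrier q′} →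
                     P ≐ P′ → Q ≐ Q′ → ∀ x → Separates P Q x → Separates P′ Q′ x
  separates-resp-≐ (P⊆P′ , _) (Q⊆Q′ , _) _ =
    ⊎-map (λ (x∈P , x*∈Q) → P⊆P′ x∈P , Q⊆Q′ x*∈Q) (λ (x*∈P , x∈Q) → P⊆P′ x*∈P , Q⊆Q′ x∈Q)

  separates-swap : ∀ {p q} (P : Pred Carrier p) (Q : Pred Carrier q) x →
                   Separates P Q x → Separates Q P x
  separates-swap _ _ _ (inj₁ (x∈P , x*∈Q)) = inj₂ (x*∈Q , x∈P)
  separates-swap _ _ _ (inj₂ (x*∈P , x∈Q)) = inj₁ (x∈Q , x*∈P)

  Separators : ∀ {p q} → Pred Carrier p → Pred Carrier q → Pred Carrier (ℓ ⊔ p ⊔ q)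
  Separators P Q = elements S ∩ Separates P Q

  S-resp : ∀ {x y} → y ∈ ⌞ x ⌟ → x ∈ elements S → y ∈ elements S
  S-resp (inj₁ y≈x)  x∈S = Subsystem.respects S (Eq.sym y≈x) x∈S
  S-resp (inj₂ y≈x*) x∈S = Subsystem.respects S (Eq.sym y≈x*) (Subsystem.*-closed S x∈S)

  module _ {p q} {P : Pred Carrier p} {Q : Pred Carrier q}
           (prfP : IsRegularProfile P) (prfQ : IsRegularProfile Q) where

    separates-resp : ∀ {x y} → y ∈ ⌞ x ⌟ → Separates P Q x → Separates P Q y
    separates-resp (inj₁ y≈x) =
      ⊎-map (λ (x∈ , x*∈) → respects prfP x≈y x∈ , respects prfQ (*-cong x≈y) x*∈)
            (λ (x*∈ , x∈) → respects prfP (*-cong x≈y) x*∈ , respects prfQ x≈y x∈)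
      where x≈y = Eq.sym y≈x
    separates-resp {x} {y} (inj₂ y≈x*) =
      [ (λ (x∈ , x*∈) → inj₂ (respects prfP x≈y* x∈ , respects prfQ x*≈y x*∈))
      , (λ (x*∈ , x∈) → inj₁ (respects prfP x*≈y x*∈ , respects prfQ x≈y* x∈)) ]′
      where
      x*≈y : x * ≈ y
      x*≈y = Eq.sym y≈x*
      x≈y* : x ≈ y *
      x≈y* = Eq.trans (Eq.sym (*-involutive x)) (*-cong x*≈y)

    -- Whichever way round the profiles are separated, one of them contains `x` itself.
    separates-regular : ∀ {x} → x ∈ elements S → Separates P Q x → ¬ CoSmall x
    separates-regular x∈S (inj₁ (x∈P , _)) = regular prfP x∈S x∈P
    separates-regular x∈S (inj₂ (_ , x∈Q)) = regular prfQ x∈S x∈Q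

    separates-or-agree : ∀ {x} → x ∈ elements S →
      Separates P Q x ⊎ (∃[ y ] (y ∈ ⌞ x ⌟ × y ∈ P × y ∈ Q))
    separates-or-agree x∈S with total prfP x∈S | total prfQ x∈S
    ... | inj₁ x∈P  | inj₂ x*∈Q = inj₁ (inj₁ (x∈P , x*∈Q))
    ... | inj₂ x*∈P | inj₁ x∈Q  = inj₁ (inj₂ (x*∈P , x∈Q))
    ... | inj₁ x∈P  | inj₁ x∈Q  = inj₂ (_ , x∈⌞x⌟ , x∈P , x∈Q)
    ... | inj₂ x*∈P | inj₂ x*∈Q = inj₂ (_ , x*∈⌞x⌟ , x*∈P , x*∈Q)

    -- The profile with `a` also has `b`, hence the join; the one with `a *` contains `(a ∨ b) *`,
    -- which lies below `a *`. Either profile may be the one with `a`, so `b` is asked of both.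
    separates-∨ : ∀ {a b} → a ∈ elements S → b ∈ elements S → a ∨ b ∈ elements S →
                  Separates P Q a → b ∈ P → b ∈ Q → Separates P Q (a ∨ b)
    separates-∨ {a} {b} a∈S b∈S ab∈S sep b∈P b∈Q = ⊎-map
      (λ (a∈ , a*∈) → join prfP a∈ b∈P , meet prfQ a*∈)
      (λ (a*∈ , a∈) → meet prfP a*∈ , join prfQ a∈ b∈Q)
      sep
      where
      join : ∀ {r} {R : Pred Carrier r} → IsRegularProfile R → a ∈ R → b ∈ R → a ∨ b ∈ R
      join prfR = ideal prfR a∈S b∈S ab∈S ≤-refl
      meet : ∀ {r} {R : Pred Carrier r} → IsRegularProfile R → a * ∈ R → (a ∨ b) * ∈ R
      meet prfR = down prfR (Subsystem.*-closed S ab∈S) (Subsystem.*-closed S a∈S)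
                    (*-antitone (x≤x∨y a b))

  -- The sets of separators splinter.

  module _ (_≤?_ : Decidable _≤_) (submodular : Submodular S)
           {p} {P Q P′ Q′ : Pred Carrier p}
           (prfP : IsRegularProfile P) (prfQ : IsRegularProfile Q)
           (prfP′ : IsRegularProfile P′) (prfQ′ : IsRegularProfile Q′) where
    open Splinter Nested nested-refl nested-sym

    -- Comparable `a` and `b` are already nested, and `b` is the witness. Otherwise submodularity
    -- for `a *` and `b` yields a corner in one of the two sets.
    splinter-agreeing : ∀ {a b} → a ∈ Separators P Q → b ∈ Separators P′ Q′ →
      a ∈ P′ → a ∈ Q′ → b ∈ P → b ∈ Q →
      SplinterAt (Separators P Q) (Separators P′ Q′) a b
    splinter-agreeing {a} {b} (a∈S , sepa) (b∈S , sepb) a∈P′ a∈Q′ b∈P b∈Q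
      with a ≤? b | b ≤? a
    ... | yes a≤b | _ =
      inj₁ (b , (b∈S , sepb) , nested-sym (≤⇒nested a≤b) , λ _ t~b → t~b)
    ... | no _    | yes b≤a =
      inj₁ (b , (b∈S , sepb) , ≤⇒nested b≤a , λ _ t~b → t~b)
    -- Incomparability supplies what `fish` asks: `a * ≤ b *` would give `b ≤ a`, and for the
    -- opposite corner `b * ≤ a *` would give `a ≤ b`.
    ... | no a≰b  | no b≰a with submodular a*∈S b∈S
      where a*∈S = Subsystem.*-closed S a∈S
    ...   | inj₁ a*∨b∈S = inj₂
      ( a * ∨ b
      , (a*∨b∈S , separates-∨ prfP prfQ (S-resp x*∈⌞x⌟ a∈S) b∈S a*∨b∈S
                    (separates-resp prfP prfQ x*∈⌞x⌟ sepa) b∈P b∈Q)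
      , nested-sym (≤⇒nested (y≤x∨y _ _))
      , λ t~a t~b → fish (b≰a ∘ x*≤y*⇒y≤x) (nested-resp x∈⌞x*⌟ t~a) t~b )
    ...   | inj₂ a*∧b∈S = inj₁
      ( b * ∨ a
      , (b*∨a∈S , separates-∨ prfP′ prfQ′ (S-resp x*∈⌞x⌟ b∈S) a∈S b*∨a∈S
                    (separates-resp prfP′ prfQ′ x*∈⌞x⌟ sepb) a∈P′ a∈Q′)
      , nested-sym (≤⇒nested (y≤x∨y _ _))
      , λ t~a t~b → fish (a≰b ∘ x*≤y*⇒y≤x) (nested-resp x∈⌞x*⌟ t~b) t~a )
      where
      b*∨a∈S : b * ∨ a ∈ elements S
      b*∨a∈S = S-resp (inj₂ (Eq.sym (deMorgan a b))) a*∧b∈S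

    -- Either `a` or `b` separates both pairs and is itself the witness, or each is replaced by an
    -- orientation that both profiles of the other pair contain. Nestedness, and with it `Corner`,
    -- does not depend on orientations.
    separators-splinter : ∀ {a b} → a ∈ Separators P Q → b ∈ Separators P′ Q′ →
                          SplinterAt (Separators P Q) (Separators P′ Q′) a b
    separators-splinter {a} {b} (a∈S , sepa) (b∈S , sepb)
      with separates-or-agree prfP′ prfQ′ a∈S | separates-or-agree prfP prfQ b∈S
    ... | inj₁ sepa′ | _ = inj₁ (a , (a∈S , sepa′) , nested-refl , λ t~a _ → t~a)
    ... | inj₂ _ | inj₁ sepb′ = inj₂ (b , (b∈S , sepb′) , nested-refl , λ _ t~b → t~b)
    ... | inj₂ (a′ , a′∈ , a′∈P′ , a′∈Q′) | inj₂ (b′ , b′∈ , b′∈P , b′∈Q) = ⊎-map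
      (λ (c , c∈ , c~a′ , corner) → c , c∈ , nested-resp a′∈ c~a′ , reorient corner)
      (λ (c , c∈ , c~b′ , corner) → c , c∈ , nested-resp b′∈ c~b′ , reorient corner)
      (splinter-agreeing
        (S-resp a′∈ a∈S , separates-resp prfP prfQ a′∈ sepa)
        (S-resp b′∈ b∈S , separates-resp prfP′ prfQ′ b′∈ sepb)
        a′∈P′ a′∈Q′ b′∈P b′∈Q)
      where
      reorient : ∀ {c} → Corner a′ b′ c → Corner a b c
      reorient corner t~a t~b =
        corner (nested-resp (⌞⌟-sym a′∈) t~a) (nested-resp (⌞⌟-sym b′∈) t~b)

  -- Abstract tangles as regular profiles.

  module _ {o} {τ : Pred Carrier o} (tangle : IsAbstractTangle S τ) where
    open IsAbstractTangle tangle
    open IsOrientation isOrientation using (exactlyOne) renaming (respects to τ-resp)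

    tangle-avoids : ∀ {x y z} → x ∈ τ → y ∈ τ → z ∈ τ → ¬ CoSmall (x ∨ y ∨ z)
    tangle-avoids {x} {y} {z} x∈τ y∈τ z∈τ cosmall =
      avoids {❴ x , y , z ❵}
        (λ { (inj₁ w≈x)        → τ-resp (Eq.sym w≈x) x∈τ
           ; (inj₂ (inj₁ w≈y)) → τ-resp (Eq.sym w≈y) y∈τ
           ; (inj₂ (inj₂ w≈z)) → τ-resp (Eq.sym w≈z) z∈τ })
        (x , y , z , ((λ w∈ → w∈) , (λ w∈ → w∈)) , cosmall)

    -- The triple `x *`, `x *`, `x` is forbidden, because `x * ≤ x * ∨ x *`.
    tangle-antisym : ∀ {x} → x ∈ τ → x * ∉ τ
    tangle-antisym x∈τ x*∈τ = tangle-avoids x*∈τ x*∈τ x∈τ (joinCoSmall (x≤x∨y _ _))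

    -- For `ideal`: were `z *` in `τ`, the triple `x`, `y`, `z *` would be forbidden, as
    -- `z ≤ x ∨ y`. For `regular`: a co-small `x` forms a forbidden triple by itself.
    tangle⇒profile : IsRegularProfile τ
    tangle⇒profile = record
      { respects = τ-resp
      ; total    = τ-total
      ; ideal    = λ x∈S y∈S z∈S z≤x∨y x∈τ y∈τ →
          [ (λ z∈τ → z∈τ)
          , (λ z*∈τ → ⊥-elim (tangle-avoids x∈τ y∈τ z*∈τ
                                (joinCoSmall (≤-trans x**≤x z≤x∨y))))
          ]′ (τ-total z∈S)
      ; regular  = λ _ x∈τ x*≤x →
          tangle-avoids x∈τ x∈τ x∈τ (joinCoSmall (≤-trans x*≤x (x≤x∨y _ _)))
      }
      where
      τ-total : ∀ {x} → x ∈ elements S → x ∈ τ ⊎ x * ∈ τ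
      τ-total x∈S with exactlyOne x∈S
      ... | _ , (y∈τ , inj₁ y≈x)  , _ = inj₁ (τ-resp y≈x y∈τ)
      ... | _ , (y∈τ , inj₂ y≈x*) , _ = inj₂ (τ-resp y≈x* y∈τ)

    -- Totality computes an orientation of `x` that lies in `τ`; if this is `x *`, then
    -- `tangle-antisym` rules out `x`.
    tangle? : Unary.Decidable (elements S) → Unary.Decidable τ
    tangle? S? x with S? x
    ... | no x∉S = no (λ x∈τ → x∉S (IsOrientation.subset isOrientation x∈τ))
    ... | yes x∈S with total tangle⇒profile x∈S
    ...   | inj₁ x∈τ  = yes x∈τ
    ...   | inj₂ x*∈τ = no (λ x∈τ → tangle-antisym x∈τ x*∈τ)

-- Decision procedures in a finite separation system.

module TreeSet {c ℓ₁ ℓ₂ ℓ} (U : Universe c ℓ₁ ℓ₂) (S : Universe.Subsystem U ℓ)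
               (_≤?_ : Decidable (Universe._≤_ U))
               (finite : Universe.Finite U S) (submodular : Universe.Submodular U S) where
  open Universe U renaming (refl to ≤-refl; trans to ≤-trans)
  open Nestedness U
  open Profiles U S
  open Membership setoid using (find; lose) renaming (_∈_ to _∈ₗ_)

  xs : List Carrier
  xs = proj₁ finite

  S⇒xs : ∀ {x} → x ∈ elements S → x ∈ₗ xs
  S⇒xs {x} = Equivalence.to (proj₂ finite x)

  xs⇒S : ∀ {x} → x ∈ₗ xs → x ∈ elements S
  xs⇒S {x} = Equivalence.from (proj₂ finite x)

  infix 4 _≈?_ _∈?_

  _≈?_ : Decidable _≈_
  x ≈? y = map′ (λ (x≤y , y≤x) → antisym x≤y y≤x)
                (λ x≈y → reflexive x≈y , reflexive (Eq.sym x≈y))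
                ((x ≤? y) ×-dec (y ≤? x))

  _∈?_ : Decidable _∈ₗ_
  x ∈? ys = Any.any? (x ≈?_) ys

  S? : Unary.Decidable (elements S)
  S? x = map′ xs⇒S S⇒xs (x ∈? xs)

  all∈S? : ∀ {r} {R : Pred Carrier r} → R Respects _≈_ → Unary.Decidable R →
           Dec (∀ {x} → x ∈ elements S → R x)
  all∈S? resp R? = map′ (λ Rxs x∈S → All.lookupₛ setoid resp Rxs (S⇒xs x∈S))
                        (λ f → All.tabulateₛ setoid (λ x∈xs → f (xs⇒S x∈xs)))
                        (All.all? R? xs)

  any∈S? : ∀ {r} {R : Pred Carrier r} → R Respects _≈_ → Unary.Decidable R →
           Dec (Satisfiable (elements S ∩ R))
  any∈S? resp R? = map′ (λ any → let x , x∈xs , Rx = find any in x , xs⇒S x∈xs , Rx)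
                        (λ (x , x∈S , Rx) → lose resp (S⇒xs x∈S) Rx)
                        (Any.any? R? xs)

  -- A finite check, by which the regular profiles can be selected from all sublists of `xs`.
  profile? : ∀ ys → Dec (IsRegularProfile (_∈ₗ ys))
  profile? ys = map′ fromClauses toClauses (total? ×-dec ideal? ×-dec regular?)
    where
    P : Pred Carrier (c ⊔ ℓ₁)
    P = _∈ₗ ys

    resp : P Respects _≈_
    resp = ∈ₛ.∈-resp-≈ setoid

    Ideal : Carrier → Carrier → Carrier → Set (c ⊔ ℓ₁ ⊔ ℓ₂)
    Ideal x y z = z ≤ x ∨ y → x ∈ P → y ∈ P → z ∈ P

    Ideal-resp : ∀ {x x′ y y′ z z′} → x ≈ x′ → y ≈ y′ → z ≈ z′ → Ideal x y z → Ideal x′ y′ z′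
    Ideal-resp x≈ y≈ z≈ f z′≤ x′∈ y′∈ = resp z≈ (f
      (≤-trans (reflexive z≈) (≤-trans z′≤
        (∨-least (≤-trans (reflexive (Eq.sym x≈)) (x≤x∨y _ _))
                 (≤-trans (reflexive (Eq.sym y≈)) (y≤x∨y _ _)))))
      (resp (Eq.sym x≈) x′∈) (resp (Eq.sym y≈) y′∈))

    Total : Set (c ⊔ ℓ₁ ⊔ ℓ)
    Total = ∀ {x} → x ∈ elements S → x ∈ P ⊎ x * ∈ P

    Ideals Regular : Set (c ⊔ ℓ₁ ⊔ ℓ₂ ⊔ ℓ)
    -- Each quantifier is followed at once by its membership hypothesis, so that `all∈S?` can be
    -- nested three deep.
    Ideals = ∀ {x} → x ∈ elements S → ∀ {y} → y ∈ elements S →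
              ∀ {z} → z ∈ elements S → Ideal x y z
    Regular = ∀ {x} → x ∈ elements S → x ∈ P → ¬ CoSmall x

    total? : Dec Total
    total? = all∈S? (λ x≈y → ⊎-map (resp x≈y) (resp (*-cong x≈y)))
                    (λ x → (x ∈? ys) ⊎-dec (x * ∈? ys))

    ideal? : Dec Ideals
    ideal? =
      all∈S? (λ x≈ f y∈S z∈S → Ideal-resp x≈ Eq.refl Eq.refl (f y∈S z∈S)) λ x →
      all∈S? (λ y≈ f z∈S → Ideal-resp Eq.refl y≈ Eq.refl (f z∈S)) λ y →
      all∈S? (Ideal-resp Eq.refl Eq.refl) λ z →
        (z ≤? (x ∨ y)) →-dec ((x ∈? ys) →-dec ((y ∈? ys) →-dec (z ∈? ys)))

    regular? : Dec Regular
    regular? = all∈S?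
      (λ x≈y f y∈P y*≤y → f (resp (Eq.sym x≈y) y∈P)
        (≤-trans (reflexive (*-cong x≈y)) (≤-trans y*≤y (reflexive (Eq.sym x≈y)))))
      (λ x → (x ∈? ys) →-dec ¬? ((x *) ≤? x))

    fromClauses : Total × Ideals × Regular → IsRegularProfile P
    fromClauses (t , i , r) = record
      { respects = resp
      ; total    = t
      ; ideal    = λ x∈S y∈S z∈S → i x∈S y∈S z∈S
      ; regular  = r
      }

    toClauses : IsRegularProfile P → Total × Ideals × Regular
    toClauses prf = total , (λ x∈S y∈S z∈S → ideal x∈S y∈S z∈S) , regular
      where open IsRegularProfile prf

  -- Nested representatives and the tree set.

  Family : List Carrier × List Carrier → Pred Carrier (c ⊔ ℓ₁ ⊔ ℓ)
  Family (ys , zs) = Separators (_∈ₗ ys) (_∈ₗ zs)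

  -- The last component provides the nonempty sets that the splinter lemma starts from.
  Separable : Pred (List Carrier × List Carrier) (c ⊔ ℓ₁ ⊔ ℓ₂ ⊔ ℓ)
  Separable (ys , zs) =
    IsRegularProfile (_∈ₗ ys) × IsRegularProfile (_∈ₗ zs) × Satisfiable (Family (ys , zs))

  -- This serves twice: to select the pairs of profiles, and to find a separator of two tangles
  -- known only to be distinct.
  separators? : ∀ {p q} {P : Pred Carrier p} {Q : Pred Carrier q} →
                P Respects _≈_ → Q Respects _≈_ →
                Unary.Decidable P → Unary.Decidable Q → Dec (Satisfiable (Separators P Q))
  separators? respP respQ P? Q? = any∈S?
    (λ x≈y → ⊎-map (λ (x∈ , x*∈) → respP x≈y x∈ , respQ (*-cong x≈y) x*∈)
                   (λ (x*∈ , x∈) → respP (*-cong x≈y) x*∈ , respQ x≈y x∈))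
    (λ x → (P? x ×-dec Q? (x *)) ⊎-dec (P? (x *) ×-dec Q? x))

  separable? : Unary.Decidable Separable
  separable? (ys , zs) = profile? ys ×-dec profile? zs ×-dec
    separators? (∈ₛ.∈-resp-≈ setoid) (∈ₛ.∈-resp-≈ setoid) (_∈? ys) (_∈? zs)

  -- N has to be built before any tangle is given, so tangles are represented by
  -- the sublists of xs that are regular profiles.
  pairs : List (List Carrier × List Carrier)
  pairs = filter separable? (cartesianProduct (sublists xs) (sublists xs))

  separable : ∀ i → Separable (lookup pairs i)
  separable i = proj₂ (∈≡.∈-filter⁻ separable? {xs = cartesianProduct (sublists xs) (sublists xs)}
                                    (∈≡.∈-lookup {xs = pairs} i))

  open Splinter Nested nested-refl nested-sym using (NestedChoice; splinter)

  choice : NestedChoice (Family ∘ lookup pairs)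
  choice = splinter _ (λ i → proj₂ (proj₂ (separable i))) λ i j →
    let P , Q , _ = separable i ; P′ , Q′ , _ = separable j
    in separators-splinter _≤?_ submodular P Q P′ Q′

  rep : Fin (length pairs) → Carrier
  rep = proj₁ choice

  rep∈ : ∀ i → rep i ∈ Family (lookup pairs i)
  rep∈ = proj₁ (proj₂ choice)

  Rep : Pred Carrier ℓ₁
  Rep x = ∃[ i ] x ∈ ⌞ rep i ⌟

  -- `N` is defined through this decision: `True` of it lives at the lowest level and can be lifted
  -- to any other.
  rep? : Unary.Decidable Rep
  rep? x = any? (λ i → (x ≈? rep i) ⊎-dec (x ≈? (rep i *)))

  represented : ∀ {p} → p ∈≡ pairs → Satisfiable (Rep ∩ Family p)
  represented p∈ = rep i , (i , x∈⌞x⌟) ,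
    subst (λ p → rep i ∈ Family p) (sym (lookup-index p∈)) (rep∈ i)
    where
    i : Fin (length pairs)
    i = Any.index p∈

  rep-resp : ∀ {x y} → y ∈ ⌞ x ⌟ → Rep x → Rep y
  rep-resp y∈ (i , x∈) = i , ⌞⌟-trans y∈ x∈

  rep-S : Rep ⊆ elements S
  rep-S (i , x∈) = S-resp x∈ (proj₁ (rep∈ i))

  -- Each orientation of a representative separates the same two regular profiles. Trivial and
  -- degenerate elements of `N` are excluded by this.
  rep-regular : ∀ {x} → Rep x → ¬ CoSmall x
  rep-regular r@(i , x∈) =
    let P , Q , _ = separable i
    in separates-regular P Q (rep-S r) (separates-resp P Q x∈ (proj₂ (rep∈ i)))

  -- Rep lives at level ℓ₁, whereas N has to be at the level ℓ of S.
  N : Subsystem ℓ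
  N = record
    { elements = λ x → Lift ℓ (True (rep? x))
    ; respects = λ x≈y x∈N → lift (fromWitness (rep-resp (inj₁ (Eq.sym x≈y)) (toWitness (lower x∈N))))
    ; *-closed = λ x∈N → lift (fromWitness (rep-resp x*∈⌞x⌟ (toWitness (lower x∈N))))
    }

  N⇒rep : ∀ {x} → x ∈ elements N → Rep x
  N⇒rep x∈N = toWitness (lower x∈N)

  rep⇒N : ∀ {x} → Rep x → x ∈ elements N
  rep⇒N r = lift (fromWitness r)

  N-isTreeSet : IsTreeSet N
  N-isTreeSet = record
    { nested = λ x∈N y∈N →
        let i , x∈ = N⇒rep x∈N ; j , y∈ = N⇒rep y∈N
        in nested-resp (⌞⌟-sym y∈) (nested-sym (nested-resp (⌞⌟-sym x∈)
             (nested-sym (proj₂ (proj₂ choice) i j))))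
    -- From `x ≤ t *` follows `t ≤ x *`, so `x ≤ t ≤ x *` and `x *` would be co-small.
    ; nontrivial = λ x∈N (t , _ , _ , (x≤t , _) , (x≤t* , _)) →
        rep-regular (rep-resp x*∈⌞x⌟ (N⇒rep x∈N))
          (≤-trans x**≤x (≤-trans x≤t (x≤y*⇒y≤x* x≤t*)))
    ; nondegenerate = λ x∈N x≈x* → rep-regular (N⇒rep x∈N) (reflexive (Eq.sym x≈x*))
    }

  -- Distinguishing the tangles.

  members : ∀ {o} {τ : Pred Carrier o} → IsAbstractTangle S τ → List Carrier
  members tangle = filter (tangle? tangle S?) xs

  -- Replaces a tangle, a predicate of any level, by a sublist of `xs`.
  members-≐ : ∀ {o} {τ : Pred Carrier o} (tangle : IsAbstractTangle S τ) →
              τ ≐ (_∈ₗ members tangle)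
  members-≐ tangle =
    (λ x∈τ → ∈ₛ.∈-filter⁺ setoid (tangle? tangle S?) respects (S⇒xs (subset x∈τ)) x∈τ) ,
    (λ x∈ → proj₂ (∈ₛ.∈-filter⁻ setoid (tangle? tangle S?) respects {xs = xs} x∈))
    where open IsOrientation (IsAbstractTangle.isOrientation tangle)

  -- `τ₂` contains `x` or `x *`, and in the latter case `x` would be a separator.
  unseparated⇒⊆ : ∀ {o} {τ₁ τ₂ : Pred Carrier o} →
                  IsAbstractTangle S τ₁ → IsAbstractTangle S τ₂ →
                  ¬ Satisfiable (Separators τ₁ τ₂) → τ₁ ⊆ τ₂
  unseparated⇒⊆ tangle₁ tangle₂ unsep {x} x∈τ₁ =
    [ (λ x∈τ₂ → x∈τ₂)
    , (λ x*∈τ₂ → contradiction (x , x∈S , inj₁ (x∈τ₁ , x*∈τ₂)) unsep)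
    ]′ (IsRegularProfile.total (tangle⇒profile tangle₂) x∈S)
    where
    x∈S : x ∈ elements S
    x∈S = IsOrientation.subset (IsAbstractTangle.isOrientation tangle₁) x∈τ₁

  -- Equal traces on `x` would put both orientations of `x` into the same tangle.
  separates⇒distinguishes : ∀ {o} {τ₁ τ₂ : Pred Carrier o} →
                            IsAbstractTangle S τ₁ → IsAbstractTangle S τ₂ →
                            ∀ {x} → Separates τ₁ τ₂ x → Distinguishes x τ₁ τ₂
  separates⇒distinguishes _ tangle₂ (inj₁ (x∈τ₁ , x*∈τ₂)) (τ₁⇒τ₂ , _) =
    tangle-antisym tangle₂ (proj₁ (τ₁⇒τ₂ (x∈τ₁ , x∈⌞x⌟))) x*∈τ₂
  separates⇒distinguishes tangle₁ _ (inj₂ (x*∈τ₁ , x∈τ₂)) (_ , τ₂⇒τ₁) =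
    tangle-antisym tangle₁ (proj₁ (τ₂⇒τ₁ (x∈τ₂ , x∈⌞x⌟))) x*∈τ₁

  module _ {o} {τ₁ τ₂ : Pred Carrier o}
           (tangle₁ : IsAbstractTangle S τ₁) (tangle₂ : IsAbstractTangle S τ₂) where

    pair : List Carrier × List Carrier
    pair = members tangle₁ , members tangle₂

    -- Regularity and the separator pass from the tangles to their lists of members, so the filter
    -- keeps the pair.
    pair∈pairs : Satisfiable (Separators τ₁ τ₂) → pair ∈≡ pairs
    pair∈pairs (x , x∈S , sep) = ∈≡.∈-filter⁺ separable?
      (∈≡.∈-cartesianProduct⁺ (filter∈sublists (tangle? tangle₁ S?) xs)
                              (filter∈sublists (tangle? tangle₂ S?) xs))
      ( profile-resp-≐ (members-≐ tangle₁) (tangle⇒profile tangle₁)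
      , profile-resp-≐ (members-≐ tangle₂) (tangle⇒profile tangle₂)
      , x , x∈S
      , separates-resp-≐ (members-≐ tangle₁) (members-≐ tangle₂) x sep )

    separated⇒distinguishedByN : Satisfiable (Separators τ₁ τ₂) →
      ∃[ s ] (s ∈ elements N × s * ∈ elements N × Distinguishes s τ₁ τ₂)
    separated⇒distinguishedByN sat =
      let s , s∈ , _ , sep = represented (pair∈pairs sat) in
      s , rep⇒N s∈ , rep⇒N (rep-resp x*∈⌞x⌟ s∈) ,
      separates⇒distinguishes tangle₁ tangle₂
        (separates-resp-≐ (≐-sym (members-≐ tangle₁)) (≐-sym (members-≐ tangle₂)) s sep)

    -- Distinctness is a mere negation and gives no witness; the search through the finite `S` does,
    -- since its failure would make each tangle contain the other.
    distinct⇒separated : ¬ (τ₁ ≐ τ₂) → Satisfiable (Separators τ₁ τ₂)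
    distinct⇒separated τ₁≭τ₂ = decidable-stable
      (separators? (respects tangle₁) (respects tangle₂)
                   (tangle? tangle₁ S?) (tangle? tangle₂ S?))
      (λ unsep → τ₁≭τ₂
        ( unseparated⇒⊆ tangle₁ tangle₂ unsep
        , unseparated⇒⊆ tangle₂ tangle₁
            (λ (x , x∈S , sep) → unsep (x , x∈S , separates-swap τ₂ τ₁ x sep)) ))
      where
      respects : ∀ {τ : Pred Carrier o} → IsAbstractTangle S τ → τ Respects _≈_
      respects tangle = IsOrientation.respects (IsAbstractTangle.isOrientation tangle)

theorem1 : ∀ {c ℓ₁ ℓ₂ ℓ o} (U : Universe c ℓ₁ ℓ₂) → let open Universe U in
    Decidable _≤_ →
    (S : Subsystem ℓ) → Finite S → Submodular S →
    ∃ λ (N : Subsystem ℓ) → elements N ⊆ elements S × IsTreeSet N ×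
    (∀ (τ₁ τ₂ : Pred Carrier o) →
    IsAbstractTangle S τ₁ → IsAbstractTangle S τ₂ → ¬ (τ₁ ≐ τ₂) →
    ∃[ s ] (s ∈ elements N × s * ∈ elements N × Distinguishes s τ₁ τ₂))
theorem1 U _≤?_ S finite submodular =
  N , (λ x∈N → rep-S (N⇒rep x∈N)) , N-isTreeSet ,
  λ _ _ tangle₁ tangle₂ τ₁≭τ₂ → separated⇒distinguishedByN tangle₁ tangle₂
    (distinct⇒separated tangle₁ tangle₂ τ₁≭τ₂)
  where open TreeSet U S _≤?_ finite submodular
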